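{- If $R_4(3) = 51$, then $R_n(3) \le n!(e - 5/8) + 1$ for all integers $n \ge 4$.
   Context: For an integer $n \ge 1$, the $n$-color Ramsey number $R_n(3) = R(3,\dots,3)$ denotes the smallest positive integer $N$ such that, for any coloring of the edges of the complete graph $K_N$ with $n$ colors, there is a monochromatic triangle. Here $e$ denotes the base of the natural logarithm. -}

module Defs where

open import Data.Nat as ℕ using (ℕ; zero; suc; _!)
import Data.Nat.Properties as ℕ
open import Data.Fin using (Fin; _<_)
import Data.Fin.Properties as Fin
open import Data.Integer as ℤ using (+_; +[1+_])
open import Data.Rational as ℚ using (ℚ; mkℚ; 0ℚ; 1ℚ; ½; ∣_∣)
import Data.Rational.Properties as ℚ
open import Data.Rational.Solver using (module +-*-Solver)
import Data.Rational.Unnormalised as ℚᵘ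
import Data.Rational.Unnormalised.Properties as ℚᵘ
open import Data.Product using (Σ-syntax; ∃-syntax; _×_; _,_; proj₁; proj₂)
open import Data.Sum using (inj₁; inj₂)
open import Relation.Binary.PropositionalEquality
  using (_≡_; refl; sym; trans; cong; subst; subst₂)

------------------------------------------------------------------------
-- Ramsey numbers

-- An edge of the complete graph K_N on the vertex set Fin N is a pair of
-- vertices i < j, so that every edge is coloured exactly once.

EdgeColoring : ℕ → ℕ → Set
EdgeColoring n N = (i j : Fin N) → i < j → Fin n

HasMonochromaticTriangle : {n N : ℕ} → EdgeColoring n N → Set
HasMonochromaticTriangle c =
  ∃[ i ] ∃[ j ] ∃[ k ] Σ[ i<j ∈ i < j ] Σ[ j<k ∈ j < k ]
    (c i j i<j ≡ c j k j<k × c i j i<j ≡ c i k (Fin.<-trans i<j j<k))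

ForcesTriangle : ℕ → ℕ → Set
ForcesTriangle n N = (c : EdgeColoring n N) → HasMonochromaticTriangle c

-- R_n(3) = N.  Least elements are unique, so this determines N from n.

record IsRamseyNumber (n N : ℕ) : Set where
  field
    positive : 1 ℕ.≤ N
    forces   : ForcesTriangle n N
    least    : ∀ M → 1 ℕ.≤ M → ForcesTriangle n M → N ℕ.≤ M

------------------------------------------------------------------------
-- Real numbers as Cauchy sequences of rationals.  There is no quotient:
-- x and y denote the same real number when x ≤ᴿ y and y ≤ᴿ x.

IsCauchy : (ℕ → ℚ) → Set
IsCauchy s = ∀ ε → 0ℚ ℚ.< ε →
  ∃[ N ] (∀ m n → N ℕ.≤ m → N ℕ.≤ n → ∣ s m ℚ.- s n ∣ ℚ.≤ ε)

record ℝ : Set where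
  constructor mkℝ
  field
    seq    : ℕ → ℚ
    cauchy : IsCauchy seq

open ℝ public

infix  4 _≤ᴿ_
infixl 6 _+ᴿ_ _-ᴿ_
infixl 7 _*ᴿ_
infix  8 -ᴿ_

-- lim xₙ ≤ lim yₙ; the slack ε is what makes this the order on the limits
-- and not the eventual pointwise order on the sequences.

_≤ᴿ_ : ℝ → ℝ → Set
x ≤ᴿ y = ∀ ε → 0ℚ ℚ.< ε →
  ∃[ N ] (∀ n → N ℕ.≤ n → seq x n ℚ.≤ seq y n ℚ.+ ε)

private
  open +-*-Solver

  +-split : ∀ a b c d → (a ℚ.- b) ℚ.+ (c ℚ.- d) ≡ (a ℚ.+ c) ℚ.- (b ℚ.+ d)
  +-split = solve 4 (λ a b c d → (a :- b) :+ (c :- d) := (a :+ c) :- (b :+ d)) refl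

  *-split : ∀ a b c d → a ℚ.* (c ℚ.- d) ℚ.+ d ℚ.* (a ℚ.- b) ≡ a ℚ.* c ℚ.- b ℚ.* d
  *-split = solve 4 (λ a b c d → a :* (c :- d) :+ d :* (a :- b) := a :* c :- b :* d) refl

  sub-add : ∀ a b → (a ℚ.- b) ℚ.+ b ≡ a
  sub-add = solve 2 (λ a b → (a :- b) :+ b := a) refl

  add-sub : ∀ a b → (a ℚ.+ b) ℚ.- a ≡ b
  add-sub = solve 2 (λ a b → (a :+ b) :- a := b) refl

  neg-sub : ∀ a b → ℚ.- (a ℚ.- b) ≡ b ℚ.- a
  neg-sub = solve 2 (λ a b → :- (a :- b) := b :- a) refl

  half-pos : ∀ {ε} → 0ℚ ℚ.< ε → 0ℚ ℚ.< ½ ℚ.* ε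
  half-pos {ε} p = subst (ℚ._< ½ ℚ.* ε) (ℚ.*-zeroʳ ½) (ℚ.*-monoʳ-<-pos ½ p)

  halves : ∀ ε → ½ ℚ.* ε ℚ.+ ½ ℚ.* ε ≡ ε
  halves ε = trans (sym (ℚ.*-distribʳ-+ ε ½ ½)) (ℚ.*-identityˡ ε)

  ≤-halves : ∀ {p q} ε → p ℚ.≤ ½ ℚ.* ε → q ℚ.≤ ½ ℚ.* ε → p ℚ.+ q ℚ.≤ ε
  ≤-halves ε p≤ q≤ = subst (_ ℚ.≤_) (halves ε) (ℚ.+-mono-≤ p≤ q≤)

  constant-cauchy : ∀ q → IsCauchy (λ _ → q)
  constant-cauchy q ε 0<ε = 0 , λ _ _ _ _ →
    subst (λ z → ∣ z ∣ ℚ.≤ ε) (sym (ℚ.+-inverseʳ q)) (ℚ.<⇒≤ 0<ε)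

  +-cauchy : ∀ {s t} → IsCauchy s → IsCauchy t → IsCauchy (λ n → s n ℚ.+ t n)
  +-cauchy {s} {t} cs ct ε 0<ε with cs _ (half-pos 0<ε) | ct _ (half-pos 0<ε)
  ... | M , p | N , q = M ℕ.⊔ N , λ m n m≥ n≥ →
    subst (λ z → ∣ z ∣ ℚ.≤ ε)
      (+-split (s m) (s n) (t m) (t n))
      (ℚ.≤-trans (ℚ.∣p+q∣≤∣p∣+∣q∣ (s m ℚ.- s n) (t m ℚ.- t n))
        (≤-halves ε
          (p m n (ℕ.m⊔n≤o⇒m≤o M N m≥) (ℕ.m⊔n≤o⇒m≤o M N n≥))
          (q m n (ℕ.m⊔n≤o⇒n≤o M N m≥) (ℕ.m⊔n≤o⇒n≤o M N n≥))))

  neg-cauchy : ∀ {s} → IsCauchy s → IsCauchy (λ n → ℚ.- s n)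
  neg-cauchy {s} cs ε 0<ε with cs ε 0<ε
  ... | N , p = N , λ m n m≥ n≥ →
    subst (ℚ._≤ ε)
      (trans (sym (ℚ.∣-p∣≡∣p∣ (s m ℚ.- s n)))
             (cong ∣_∣ (ℚ.neg-distrib-+ (s m) (ℚ.- s n))))
      (p m n m≥ n≥)

  EventuallyBoundedBy : (ℕ → ℚ) → ℚ → Set
  EventuallyBoundedBy s B = ∃[ N ] (∀ n → N ℕ.≤ n → ∣ s n ∣ ℚ.≤ B)

  eventually-bounded : ∀ s → IsCauchy s →
    ∃[ B ] (ℚ.Positive B × EventuallyBoundedBy s B)
  eventually-bounded s cs =
      1ℚ ℚ.+ ∣ s N ∣
    , ℚ.pos+nonNeg⇒pos 1ℚ ∣ s N ∣ {{ℚ.∣-∣-nonNeg (s N)}}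
    , N , λ n n≥ →
      subst (λ z → ∣ z ∣ ℚ.≤ 1ℚ ℚ.+ ∣ s N ∣)
        (sub-add (s n) (s N))
        (ℚ.≤-trans (ℚ.∣p+q∣≤∣p∣+∣q∣ (s n ℚ.- s N) (s N))
          (ℚ.+-monoˡ-≤ ∣ s N ∣ (proj₂ close n N n≥ ℕ.≤-refl)))
    where
    close = cs 1ℚ (ℚ.positive⁻¹ 1ℚ)
    N = proj₁ close

  ∣*∣-≤ : ∀ p q B ε .{{_ : ℚ.Positive B}} → ∣ p ∣ ℚ.≤ B →
    ∣ q ∣ ℚ.≤ (ℚ.1/ B) {{ℚ.pos⇒nonZero B}} ℚ.* ε → ∣ p ℚ.* q ∣ ℚ.≤ ε
  ∣*∣-≤ p q B ε p≤B q≤ = subst₂ ℚ._≤_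
    (sym (ℚ.∣p*q∣≡∣p∣*∣q∣ p q))
    (trans (sym (ℚ.*-assoc B _ ε))
      (trans (cong (ℚ._* ε) (ℚ.*-inverseʳ B {{ℚ.pos⇒nonZero B}})) (ℚ.*-identityˡ ε)))
    (ℚ.≤-trans (ℚ.*-monoʳ-≤-nonNeg ∣ q ∣ {{ℚ.∣-∣-nonNeg q}} p≤B)
      (ℚ.*-monoˡ-≤-nonNeg B {{ℚ.pos⇒nonNeg B}} q≤))

  1/*-pos : ∀ ε B .{{_ : ℚ.Positive B}} → 0ℚ ℚ.< ε →
    0ℚ ℚ.< (ℚ.1/ B) {{ℚ.pos⇒nonZero B}} ℚ.* ε
  1/*-pos ε B 0<ε = subst (ℚ._< 1/B ℚ.* ε) (ℚ.*-zeroʳ 1/B)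
    (ℚ.*-monoʳ-<-pos 1/B {{ℚ.1/pos⇒pos B}} 0<ε)
    where 1/B = (ℚ.1/ B) {{ℚ.pos⇒nonZero B}}

  *-close : ∀ a b c d A B ε .{{_ : ℚ.Positive A}} .{{_ : ℚ.Positive B}} →
    ∣ a ∣ ℚ.≤ A → ∣ d ∣ ℚ.≤ B →
    ∣ c ℚ.- d ∣ ℚ.≤ (ℚ.1/ A) {{ℚ.pos⇒nonZero A}} ℚ.* (½ ℚ.* ε) →
    ∣ a ℚ.- b ∣ ℚ.≤ (ℚ.1/ B) {{ℚ.pos⇒nonZero B}} ℚ.* (½ ℚ.* ε) →
    ∣ a ℚ.* c ℚ.- b ℚ.* d ∣ ℚ.≤ ε
  *-close a b c d A B ε a≤A d≤B c-d a-b =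
    subst (λ z → ∣ z ∣ ℚ.≤ ε) (*-split a b c d)
      (ℚ.≤-trans (ℚ.∣p+q∣≤∣p∣+∣q∣ (a ℚ.* (c ℚ.- d)) (d ℚ.* (a ℚ.- b)))
        (≤-halves ε
          (∣*∣-≤ a (c ℚ.- d) A (½ ℚ.* ε) a≤A c-d)
          (∣*∣-≤ d (a ℚ.- b) B (½ ℚ.* ε) d≤B a-b)))

  *-cauchy′ : ∀ s t A B → ℚ.Positive A → ℚ.Positive B →
    EventuallyBoundedBy s A → EventuallyBoundedBy t B →
    IsCauchy s → IsCauchy t → IsCauchy (λ n → s n ℚ.* t n)
  *-cauchy′ s t A B A>0 B>0 (K , bs) (L , bt) cs ct ε 0<ε =
    (K ℕ.⊔ L) ℕ.⊔ (M ℕ.⊔ N) , λ m n m≥ n≥ →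
      *-close (s m) (s n) (t m) (t n) A B ε {{A>0}} {{B>0}}
        (bs m (ℕ.m⊔n≤o⇒m≤o K L (left m≥)))
        (bt n (ℕ.m⊔n≤o⇒n≤o K L (left n≥)))
        (proj₂ t-close m n (ℕ.m⊔n≤o⇒m≤o M N (right m≥)) (ℕ.m⊔n≤o⇒m≤o M N (right n≥)))
        (proj₂ s-close m n (ℕ.m⊔n≤o⇒n≤o M N (right m≥)) (ℕ.m⊔n≤o⇒n≤o M N (right n≥)))
    where
    t-close = ct _ (1/*-pos (½ ℚ.* ε) A {{A>0}} (half-pos 0<ε))
    s-close = cs _ (1/*-pos (½ ℚ.* ε) B {{B>0}} (half-pos 0<ε))
    M = proj₁ t-close
    N = proj₁ s-close
    left : ∀ {x} → (K ℕ.⊔ L) ℕ.⊔ (M ℕ.⊔ N) ℕ.≤ x → K ℕ.⊔ L ℕ.≤ x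
    left = ℕ.m⊔n≤o⇒m≤o (K ℕ.⊔ L) (M ℕ.⊔ N)
    right : ∀ {x} → (K ℕ.⊔ L) ℕ.⊔ (M ℕ.⊔ N) ℕ.≤ x → M ℕ.⊔ N ℕ.≤ x
    right = ℕ.m⊔n≤o⇒n≤o (K ℕ.⊔ L) (M ℕ.⊔ N)

  *-cauchy : ∀ s t → IsCauchy s → IsCauchy t → IsCauchy (λ n → s n ℚ.* t n)
  *-cauchy s t cs ct =
    let A , A>0 , bs = eventually-bounded s cs
        B , B>0 , bt = eventually-bounded t ct
    in *-cauchy′ s t A B A>0 B>0 bs bt cs ct

fromℚ : ℚ → ℝ
fromℚ q = mkℝ (λ _ → q) (constant-cauchy q)

fromℕ : ℕ → ℝ
fromℕ n = fromℚ (+ n ℚ./ 1)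

_+ᴿ_ : ℝ → ℝ → ℝ
x +ᴿ y = mkℝ (λ n → seq x n ℚ.+ seq y n)
  (+-cauchy {seq x} {seq y} (cauchy x) (cauchy y))

-ᴿ_ : ℝ → ℝ
-ᴿ x = mkℝ (λ n → ℚ.- seq x n) (neg-cauchy {seq x} (cauchy x))

_-ᴿ_ : ℝ → ℝ → ℝ
x -ᴿ y = x +ᴿ (-ᴿ y)

_*ᴿ_ : ℝ → ℝ → ℝ
x *ᴿ y = mkℝ (λ n → seq x n ℚ.* seq y n)
  (*-cauchy (seq x) (seq y) (cauchy x) (cauchy y))

------------------------------------------------------------------------
-- The base of the natural logarithm, e = Σ_{k ≥ 0} 1/k!

1/_! : ℕ → ℚ
1/ n ! = (+ 1 ℚ./ (n !)) {{n ℕ.!≢0}}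

expSum : ℕ → ℚ
expSum zero    = 1/ 0 !
expSum (suc n) = expSum n ℚ.+ 1/ suc n !

private
  recip : ∀ k .{{_ : ℕ.NonZero k}} → ℚ
  recip k = + 1 ℚ./ k

  recip-≃ : ∀ k → ℚ.toℚᵘ (recip (suc k)) ℚᵘ.≃ ℚᵘ.mkℚᵘ (+ 1) k
  recip-≃ k = ℚ.toℚᵘ-fromℚᵘ (ℚᵘ.mkℚᵘ (+ 1) k)

  recip≥0 : ∀ k .{{_ : ℕ.NonZero k}} → 0ℚ ℚ.≤ recip k
  recip≥0 (suc k) = ℚ.toℚᵘ-cancel-≤
    (ℚᵘ.≤-respʳ-≃ (ℚᵘ.≃-sym (recip-≃ k)) (ℚᵘ.*≤* (ℤ.+≤+ ℕ.z≤n)))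

  recip-≤-ε : ∀ ε → 0ℚ ℚ.< ε →
    ∃[ N ] (∀ k .{{_ : ℕ.NonZero k}} → N ℕ.≤ k → recip k ℚ.≤ ε)
  recip-≤-ε (mkℚ (+ zero) d _) (ℚ.*<* (ℤ.+<+ ()))
  recip-≤-ε (mkℚ +[1+ a ] d _) _ = suc d , λ where
    (suc k) d<k → ℚ.toℚᵘ-cancel-≤
      (ℚᵘ.≤-respˡ-≃ (ℚᵘ.≃-sym (recip-≃ k))
        (ℚᵘ.*≤* (ℤ.+≤+ (ℕ.*-mono-≤ (ℕ.s≤s (ℕ.z≤n {a})) d<k))))

  recip-double : ∀ j k .{{_ : ℕ.NonZero j}} .{{_ : ℕ.NonZero k}} →
    2 ℕ.* k ℕ.≤ j → recip j ℚ.+ recip j ℚ.≤ recip k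
  recip-double (suc j) (suc k) h = ℚ.toℚᵘ-cancel-≤
    (ℚᵘ.≤-respˡ-≃ (ℚᵘ.≃-sym (ℚ.toℚᵘ-homo-+ (recip (suc j)) (recip (suc j))))
    (ℚᵘ.≤-respˡ-≃ (ℚᵘ.≃-sym (ℚᵘ.+-cong (recip-≃ j) (recip-≃ j)))
    (ℚᵘ.≤-respʳ-≃ (ℚᵘ.≃-sym (recip-≃ k))
      (ℚᵘ.*≤* (ℤ.+≤+ ineq)))))
    where
    open ℕ.≤-Reasoning
    J = suc j
    K = suc k
    ineq : (1 ℕ.* J ℕ.+ 1 ℕ.* J) ℕ.* K ℕ.≤ 1 ℕ.* (J ℕ.* J)
    ineq = begin
      (1 ℕ.* J ℕ.+ 1 ℕ.* J) ℕ.* K ≡⟨ cong (ℕ._* K) (ℕ.*-distribʳ-+ J 1 1) ⟨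
      (2 ℕ.* J) ℕ.* K             ≡⟨ cong (ℕ._* K) (ℕ.*-comm 2 J) ⟩
      (J ℕ.* 2) ℕ.* K             ≡⟨ ℕ.*-assoc J 2 K ⟩
      J ℕ.* (2 ℕ.* K)             ≤⟨ ℕ.*-monoʳ-≤ J h ⟩
      J ℕ.* J                     ≡⟨ ℕ.*-identityˡ (J ℕ.* J) ⟨
      1 ℕ.* (J ℕ.* J)             ∎

  n≤n! : ∀ n → n ℕ.≤ n !
  n≤n! zero    = ℕ.z≤n
  n≤n! (suc n) = subst (ℕ._≤ suc n !) (ℕ.*-identityʳ (suc n))
    (ℕ.*-monoʳ-≤ (suc n) (ℕ.1≤n! n))

  -- For n ≥ 1 the intervals [expSum n , expSum n + 1/n!] are nested.

  expSum-bounds : ∀ n k → 1 ℕ.≤ n →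
    (expSum n ℚ.≤ expSum (k ℕ.+ n)) ×
    (expSum (k ℕ.+ n) ℚ.+ 1/ k ℕ.+ n ! ℚ.≤ expSum n ℚ.+ 1/ n !)
  expSum-bounds n zero    1≤n = ℚ.≤-refl , ℚ.≤-refl
  expSum-bounds n (suc k) 1≤n with expSum-bounds n k 1≤n
  ... | lo , hi =
      ℚ.≤-trans lo (subst (ℚ._≤ S ℚ.+ u′) (ℚ.+-identityʳ S)
        (ℚ.+-monoʳ-≤ S (recip≥0 (suc m !) {{suc m ℕ.!≢0}})))
    , ℚ.≤-trans
        (subst (ℚ._≤ S ℚ.+ u) (sym (ℚ.+-assoc S u′ u′))
          (ℚ.+-monoʳ-≤ S (recip-double (suc m !) (m !) {{suc m ℕ.!≢0}} {{m ℕ.!≢0}}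
            (ℕ.*-monoˡ-≤ (m !) (ℕ.s≤s (ℕ.≤-trans 1≤n (ℕ.m≤n+m n k)))))))
        hi
    where
    m  = k ℕ.+ n
    S  = expSum m
    u  = 1/ m !
    u′ = 1/ suc m !

  expSum-close : ∀ {n m} → 1 ℕ.≤ n → n ℕ.≤ m →
    ∣ expSum m ℚ.- expSum n ∣ ℚ.≤ 1/ n !
  expSum-close {n} {m} 1≤n n≤m with expSum-bounds n (m ℕ.∸ n) 1≤n
  ... | lo , hi rewrite ℕ.m∸n+n≡m n≤m =
    subst (ℚ._≤ 1/ n !) (sym (ℚ.0≤p⇒∣p∣≡p diff≥0))
      (subst (expSum m ℚ.- expSum n ℚ.≤_)
        (add-sub (expSum n) (1/ n !))
        (ℚ.+-monoˡ-≤ (ℚ.- expSum n)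
          (ℚ.≤-trans
            (subst (ℚ._≤ expSum m ℚ.+ 1/ m !) (ℚ.+-identityʳ (expSum m))
              (ℚ.+-monoʳ-≤ (expSum m) (recip≥0 (m !) {{m ℕ.!≢0}})))
            hi)))
    where
    diff≥0 : 0ℚ ℚ.≤ expSum m ℚ.- expSum n
    diff≥0 = subst (ℚ._≤ expSum m ℚ.- expSum n) (ℚ.+-inverseʳ (expSum n))
      (ℚ.+-monoˡ-≤ (ℚ.- expSum n) lo)

  ∣-∣-sym : ∀ p q → ∣ p ℚ.- q ∣ ≡ ∣ q ℚ.- p ∣
  ∣-∣-sym p q = trans (sym (ℚ.∣-p∣≡∣p∣ (p ℚ.- q)))
    (cong ∣_∣ (neg-sub p q))

  expSum-cauchy : IsCauchy expSum
  expSum-cauchy ε 0<ε with recip-≤-ε ε 0<ε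
  ... | N , small = suc N , λ m n N<m N<n → case m n N<m N<n (ℕ.≤-total m n)
    where
    small! : ∀ n → suc N ℕ.≤ n → 1/ n ! ℚ.≤ ε
    small! n N<n = small (n !) {{n ℕ.!≢0}} (ℕ.≤-trans (ℕ.<⇒≤ N<n) (n≤n! n))

    case : ∀ m n → suc N ℕ.≤ m → suc N ℕ.≤ n → _ →
      ∣ expSum m ℚ.- expSum n ∣ ℚ.≤ ε
    case m n N<m N<n (inj₁ m≤n) =
      subst (ℚ._≤ ε) (∣-∣-sym (expSum n) (expSum m))
        (ℚ.≤-trans (expSum-close (ℕ.≤-trans (ℕ.s≤s ℕ.z≤n) N<m) m≤n) (small! m N<m))
    case m n N<m N<n (inj₂ n≤m) =
      ℚ.≤-trans (expSum-close (ℕ.≤-trans (ℕ.s≤s ℕ.z≤n) N<n) n≤m) (small! n N<n)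

e : ℝ
e = mkℝ expSum expSum-cauchy

{-# OPTIONS --safe #-}

-- Pigeonhole at one vertex gives R_{n+1}(3) − 1 ≤ (n+1)(R_n(3) − 1) + 1.
-- Dividing by (n+1)! and telescoping from R_4(3) − 1 = 50,
--   (R_n(3) − 1)/n! ≤ 50/4! + Σ_{4<k≤n} 1/k! = Σ_{k≤n} 1/k! − 5/8 ≤ e − 5/8,
-- because 50/4! − Σ_{k≤4} 1/k! = 50/24 − 65/24 = −5/8.
module Submission where

open import Defs
open import Data.Nat using (ℕ; _≤_; _!)
open import Data.Integer using (+_)
open import Data.Rational using (_/_)

open import Data.Nat using (zero; suc; _+_; _*_; NonZero; z≤n; s≤s; z<s; s<s; _≤′_; ≤′-refl; ≤′-step)
import Data.Nat.Properties as ℕ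
open import Data.Fin using (Fin; zero; suc; _<_; punchOut)
import Data.Fin.Properties as Fin
import Data.Integer as ℤ
import Data.Integer.Properties as ℤ
open import Data.Rational as ℚ using (ℚ; 0ℚ; 1ℚ; fromℚᵘ)
import Data.Rational.Properties as ℚ
open import Data.Rational.Solver using (module +-*-Solver)
open import Data.Rational.Unnormalised as ℚᵘ using (mkℚᵘ; *≡*; *≤*)
import Data.Rational.Unnormalised.Properties as ℚᵘ
open import Data.Product using (Σ-syntax; ∃-syntax; _,_; proj₁; proj₂)
open import Data.Sum using (_⊎_; inj₁; inj₂)
open import Function using (_∘_; case_of_)
open import Relation.Binary.PropositionalEquality
  using (_≡_; _≢_; refl; sym; trans; cong; cong₂; subst; module ≡-Reasoning)
open import Relation.Nullary using (Dec; yes; no; ¬_; contradiction)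
open import Relation.Nullary.Decidable using (map′)

-- Order-preserving selections and the pigeonhole principle.

-- Strict monotonicity lets an edge colouring, given on pairs `i < j` alone, be pulled back without
-- reordering vertices.
record Selection {K : ℕ} (P : Fin K → Set) (m : ℕ) : Set where
  field
    vertex     : Fin m → Fin K
    increasing : ∀ {i j} → i < j → vertex i < vertex j
    satisfies  : ∀ i → P (vertex i)

open Selection

empty : ∀ {K} {P : Fin K → Set} → Selection P 0
empty .vertex ()
empty .increasing {()}
empty .satisfies ()

shift : ∀ {K m} {P : Fin (suc K) → Set} → Selection (P ∘ suc) m → Selection P m
shift S .vertex     = suc ∘ vertex S
shift S .increasing = s<s ∘ increasing S
shift S .satisfies  = satisfies S

cons : ∀ {K m} {P : Fin (suc K) → Set} →
  P zero → Selection (P ∘ suc) m → Selection P (suc m)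
cons p S .vertex zero    = zero
cons p S .vertex (suc i) = suc (vertex S i)
cons p S .increasing {zero}  {suc j} _         = z<s
cons p S .increasing {suc i} {suc j} (s≤s i<j) = s<s (increasing S i<j)
cons p S .satisfies zero    = p
cons p S .satisfies (suc i) = satisfies S i

-- Falling short of both targets allows at most `(a - 1) + (b - 1)` elements. In the induction,
-- vertex `zero` lowers the target of its own class by one.
split : ∀ {K} {P Q : Fin K → Set} → (∀ x → P x ⊎ Q x) →
  ∀ a b → a + b ≤ suc K → Selection P a ⊎ Selection Q b
split             d zero    b       _ = inj₁ empty
split             d (suc a) zero    _ = inj₂ empty
split {zero}      d (suc a) (suc b) (s≤s a+1+b≤0) =
  contradiction (ℕ.≤-trans (ℕ.m≤n+m (suc b) a) a+1+b≤0) λ ()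
split {suc K} {P} {Q} d (suc a) (suc b) (s≤s a+1+b≤1+K) with d zero
... | inj₁ p with split {P = P ∘ suc} {Q ∘ suc} (d ∘ suc) a (suc b) a+1+b≤1+K
...   | inj₁ S = inj₁ (cons p S)
...   | inj₂ T = inj₂ (shift T)
split {suc K} {P} {Q} d (suc a) (suc b) (s≤s a+1+b≤1+K)
    | inj₂ q with split {P = P ∘ suc} {Q ∘ suc} (d ∘ suc) (suc a) b
                    (subst (_≤ suc K) (ℕ.+-suc a b) a+1+b≤1+K)
...   | inj₁ S = inj₁ (shift S)
...   | inj₂ T = inj₂ (cons q T)

-- Induction on the number of colours: split colour `zero` from the rest. If `zero` is rare, the
-- other class has the `suc (n * m)` elements that the recursive call needs, with each colour
-- lowered by one.
pigeonhole : ∀ n m {K} (f : Fin K → Fin n) → suc (n * m) ≤ K →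
  ∃[ k ] Selection (λ x → f x ≡ k) (suc m)
pigeonhole zero    m {suc K} f _ = case f zero of λ ()
pigeonhole (suc n) m {K} f big =
  case split zero-or-suc (suc m) (suc (n * m)) (s≤s enough) of λ where
    (inj₁ S) → zero , S
    (inj₂ T) →
      let k , U = pigeonhole n m (proj₁ ∘ satisfies T) ℕ.≤-refl in
      suc k , record
        { vertex     = vertex T ∘ vertex U
        ; increasing = increasing T ∘ increasing U
        ; satisfies  = λ i →
            trans (proj₂ (satisfies T (vertex U i))) (cong suc (satisfies U i))
        }
  where
  enough : m + suc (n * m) ≤ K
  enough = subst (_≤ K) (sym (ℕ.+-suc m (n * m))) big

  zero-or-suc : ∀ x → f x ≡ zero ⊎ (∃[ y ] f x ≡ suc y)
  zero-or-suc x with f x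
  ... | zero  = inj₁ refl
  ... | suc y = inj₂ (y , refl)

-- The recursion for triangle-forcing.

restrict : ∀ {n K m} {P : Fin K → Set} →
  EdgeColoring n K → Selection P m → EdgeColoring n m
restrict c S i j i<j = c (vertex S i) (vertex S j) (increasing S i<j)

restrict-triangle : ∀ {n K m} {P : Fin K → Set}
  (c : EdgeColoring n K) (S : Selection P m) →
  HasMonochromaticTriangle (restrict c S) → HasMonochromaticTriangle c
restrict-triangle c S (i , j , k , i<j , j<k , ij≡jk , ij≡ik) =
  vertex S i , vertex S j , vertex S k , increasing S i<j , increasing S j<k ,
  -- The long edge carries two different proofs of `<`: the image of a transitivity proof and the
  -- transitivity of the images.
  ij≡jk , trans ij≡ik (cong (c _ _) (Fin.<-irrelevant _ _))

EdgeColored : ∀ {n N} → EdgeColoring n N → Fin n → Set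
EdgeColored c k = ∃[ i ] ∃[ j ] Σ[ i<j ∈ i < j ] c i j i<j ≡ k

-- Finite search makes the case distinction in `forces-suc` constructive.
edgeColored? : ∀ {n N} (c : EdgeColoring n N) k → Dec (EdgeColored c k)
edgeColored? c k = Fin.any? λ i → Fin.any? λ j → edge? i j
  where
  edge? : ∀ i j → Dec (Σ[ i<j ∈ i < j ] c i j i<j ≡ k)
  edge? i j with i Fin.<? j
  ... | no  i≮j = no (i≮j ∘ proj₁)
  ... | yes i<j = map′ (i<j ,_)
    (λ (p , eq) → trans (cong (c i j) (Fin.<-irrelevant i<j p)) eq)
    (c i j i<j Fin.≟ k)

-- Punching out `k` renumbers the remaining colours injectively, so equal colours in `c′` come from
-- equal colours in `c`.
avoid-color : ∀ {n N} → ForcesTriangle n N → (c : EdgeColoring (suc n) N) →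
  ∀ k → ¬ EdgeColored c k → HasMonochromaticTriangle c
avoid-color {n} {N} forces c k avoids =
  let i , j , l , i<j , j<l , ij≡jl , ij≡il = forces c′ in
  i , j , l , i<j , j<l ,
  Fin.punchOut-injective (k≢c i<j) (k≢c j<l) ij≡jl ,
  Fin.punchOut-injective (k≢c i<j) (k≢c (Fin.<-trans i<j j<l)) ij≡il
  where
  k≢c : ∀ {i j} (i<j : i < j) → k ≢ c i j i<j
  k≢c i<j k≡c = avoids (_ , _ , i<j , sym k≡c)

  c′ : EdgeColoring n N
  c′ i j i<j = punchOut (k≢c i<j)

-- Vertex `zero` has `suc (suc n * m)` neighbours, so `suc m` of them are joined to it in one colour
-- `k`. An edge of colour `k` among these closes a triangle with `zero`; otherwise they span a
-- colouring avoiding `k`.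
forces-suc : ∀ n m → ForcesTriangle n (suc m) →
  ForcesTriangle (suc n) (suc (suc (suc n * m)))
forces-suc n m forces c =
  case edgeColored? (restrict c S) k of λ where
    (yes (i , j , i<j , ij≡k)) →
      zero , vertex S i , vertex S j , z<s , increasing S i<j ,
      trans (color i) (sym ij≡k) , trans (color i) (sym (color j))
    (no avoids) →
      restrict-triangle c S (avoid-color forces (restrict c S) k avoids)
  where
  popular = pigeonhole (suc n) m (λ x → c zero (suc x) z<s) ℕ.≤-refl
  k = proj₁ popular
  -- The predicate packs its own proof of `zero < x`, since after `shift` the selection ranges over
  -- all vertices, including `zero`.
  S : Selection (λ x → ∃[ 0<x ] c zero x 0<x ≡ k) (suc m)
  S = shift record
    { vertex     = vertex (proj₂ popular)
    ; increasing = increasing (proj₂ popular)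
    ; satisfies  = λ i → z<s , satisfies (proj₂ popular) i
    }
  color : ∀ i {0<x} → c zero (vertex S i) 0<x ≡ k
  color i = trans (cong (c zero (vertex S i)) (ℕ.<-irrelevant _ _)) (proj₂ (satisfies S i))

-- The bound on R_n(3) − 1 for n = 4 + j.
bound : ℕ → ℕ
bound zero    = 50
bound (suc j) = suc ((5 + j) * bound j)

forces-bound : ForcesTriangle 4 51 →
  ∀ j → ForcesTriangle (4 + j) (suc (bound j))
forces-bound forces zero    = forces
forces-bound forces (suc j) =
  forces-suc (4 + j) (bound j) (forces-bound forces j)

-- Rational arithmetic and the partial sums of `e`.

-- Serves to verify identities by cross-multiplying unnormalised fractions, where no gcd blocks
-- evaluation. It follows from `toℚᵘ` being a homomorphism inverse to `fromℚᵘ`.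
fromℚᵘ-homo-+ : ∀ p q → fromℚᵘ (p ℚᵘ.+ q) ≡ fromℚᵘ p ℚ.+ fromℚᵘ q
fromℚᵘ-homo-+ p q = trans
  (ℚ.fromℚᵘ-cong (ℚᵘ.≃-sym (ℚᵘ.≃-trans (ℚ.toℚᵘ-homo-+ (fromℚᵘ p) (fromℚᵘ q))
    (ℚᵘ.+-cong (ℚ.toℚᵘ-fromℚᵘ p) (ℚ.toℚᵘ-fromℚᵘ q)))))
  (ℚ.fromℚᵘ-toℚᵘ _)

fromℚᵘ-homo-* : ∀ p q → fromℚᵘ (p ℚᵘ.* q) ≡ fromℚᵘ p ℚ.* fromℚᵘ q
fromℚᵘ-homo-* p q = trans
  (ℚ.fromℚᵘ-cong (ℚᵘ.≃-sym (ℚᵘ.≃-trans (ℚ.toℚᵘ-homo-* (fromℚᵘ p) (fromℚᵘ q))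
    (ℚᵘ.*-cong (ℚ.toℚᵘ-fromℚᵘ p) (ℚ.toℚᵘ-fromℚᵘ q)))))
  (ℚ.fromℚᵘ-toℚᵘ _)

fromℚᵘ-mono-≤ : ∀ p q → p ℚᵘ.≤ q → fromℚᵘ p ℚ.≤ fromℚᵘ q
fromℚᵘ-mono-≤ p q p≤q = ℚ.toℚᵘ-cancel-≤
  (ℚᵘ.≤-respˡ-≃ (ℚᵘ.≃-sym (ℚ.toℚᵘ-fromℚᵘ p))
    (ℚᵘ.≤-respʳ-≃ (ℚᵘ.≃-sym (ℚ.toℚᵘ-fromℚᵘ q)) p≤q))

ι : ℕ → ℚ
ι n = + n / 1

ι-* : ∀ m n → ι (m * n) ≡ ι m ℚ.* ι n
ι-* m n = trans (cong (_/ 1) (ℤ.pos-* m n))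
  (fromℚᵘ-homo-* (mkℚᵘ (+ m) 0) (mkℚᵘ (+ n) 0))

ι-suc : ∀ n → ι (suc n) ≡ ι n ℚ.+ 1ℚ
ι-suc n = trans
  (ℚ.fromℚᵘ-cong {mkℚᵘ (+ suc n) 0} {mkℚᵘ (+ n) 0 ℚᵘ.+ ℚᵘ.1ℚᵘ}
    (*≡* (cong (ℤ._* + 1) (trans (cong +_ (sym (ℕ.+-comm n 1)))
      (cong (ℤ._+ + 1) (sym (ℤ.*-identityʳ (+ n))))))))
  (fromℚᵘ-homo-+ (mkℚᵘ (+ n) 0) ℚᵘ.1ℚᵘ)

ι-mono-≤ : ∀ {m n} → m ≤ n → ι m ℚ.≤ ι n
ι-mono-≤ {m} {n} m≤n = fromℚᵘ-mono-≤ (mkℚᵘ (+ m) 0) (mkℚᵘ (+ n) 0)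
  (*≤* (ℤ.*-monoʳ-≤-nonNeg (+ 1) (ℤ.+≤+ m≤n)))

ι-*-recip : ∀ n .{{_ : NonZero n}} → ι n ℚ.* (+ 1 / n) ≡ 1ℚ
ι-*-recip (suc n) = trans
  (sym (fromℚᵘ-homo-* (mkℚᵘ (+ suc n) 0) (mkℚᵘ (+ 1) n)))
  (ℚ.fromℚᵘ-cong {mkℚᵘ (+ suc n) 0 ℚᵘ.* mkℚᵘ (+ 1) n} {ℚᵘ.1ℚᵘ}
    (*≡* (cong +_ (cong suc (eq n)))))
  where
  eq : ∀ n → n * 1 * 1 ≡ n + 0 + 0
  eq n = trans (ℕ.*-identityʳ (n * 1)) (trans (ℕ.*-identityʳ n)
    (sym (trans (ℕ.+-identityʳ (n + 0)) (ℕ.+-identityʳ n))))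

1/!-nonNeg : ∀ n → 0ℚ ℚ.≤ 1/ n !
1/!-nonNeg n = ℚ.nonNegative⁻¹ (1/ n !)
  {{ℚ.normalize-nonNeg 1 (n !) {{n ℕ.!≢0}}}}

expSum-mono-≤ : ∀ {m n} → m ≤ n → expSum m ℚ.≤ expSum n
expSum-mono-≤ = mono ∘ ℕ.≤⇒≤′
  where
  mono : ∀ {m n} → m ≤′ n → expSum m ℚ.≤ expSum n
  mono ≤′-refl = ℚ.≤-refl
  mono {m} (≤′-step {n} m≤′n) = ℚ.≤-trans (mono m≤′n)
    (subst (ℚ._≤ expSum (suc n)) (ℚ.+-identityʳ (expSum n))
      (ℚ.+-monoʳ-≤ (expSum n) (1/!-nonNeg (suc n))))

-- The newest summand of `expSum` contributes exactly 1. Hence, for every constant `c`, these values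
-- obey the recursion that defines `bound`; the starting value determines `c`.
!*expSum-suc : ∀ n c → ι (suc n !) ℚ.* (expSum (suc n) ℚ.- c) ≡
  ι (suc n) ℚ.* (ι (n !) ℚ.* (expSum n ℚ.- c)) ℚ.+ 1ℚ
!*expSum-suc n c = begin
  ι (suc n !) ℚ.* ((expSum n ℚ.+ u) ℚ.- c)
    ≡⟨ distrib (ι (suc n !)) (expSum n) u c ⟩
  ι (suc n !) ℚ.* (expSum n ℚ.- c) ℚ.+ ι (suc n !) ℚ.* u
    ≡⟨ cong₂ ℚ._+_
         (trans (cong (ℚ._* (expSum n ℚ.- c)) (ι-* (suc n) (n !)))
           (ℚ.*-assoc (ι (suc n)) (ι (n !)) (expSum n ℚ.- c)))
         (ι-*-recip (suc n !) {{suc n ℕ.!≢0}}) ⟩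
  ι (suc n) ℚ.* (ι (n !) ℚ.* (expSum n ℚ.- c)) ℚ.+ 1ℚ ∎
  where
  open ≡-Reasoning
  open +-*-Solver
  u = 1/ suc n !
  distrib : ∀ f s u c →
    f ℚ.* ((s ℚ.+ u) ℚ.- c) ≡ f ℚ.* (s ℚ.- c) ℚ.+ f ℚ.* u
  distrib = solve 4 (λ f s u c →
    f :* ((s :+ u) :- c) := f :* (s :- c) :+ f :* u) refl

bound-closed-form : ∀ j →
  ι (bound j) ≡ ι ((4 + j) !) ℚ.* (expSum (4 + j) ℚ.- + 5 / 8)
-- By evaluation: 24 (65/24 - 15/24) = 50.
bound-closed-form zero    = refl
bound-closed-form (suc j) = begin
  ι (suc ((5 + j) * bound j))       ≡⟨ ι-suc ((5 + j) * bound j) ⟩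
  ι ((5 + j) * bound j) ℚ.+ 1ℚ      ≡⟨ cong (ℚ._+ 1ℚ) (ι-* (5 + j) (bound j)) ⟩
  ι (5 + j) ℚ.* ι (bound j) ℚ.+ 1ℚ
    ≡⟨ cong (λ b → ι (5 + j) ℚ.* b ℚ.+ 1ℚ) (bound-closed-form j) ⟩
  ι (5 + j) ℚ.* (ι ((4 + j) !) ℚ.* (expSum (4 + j) ℚ.- + 5 / 8)) ℚ.+ 1ℚ
    ≡⟨ !*expSum-suc (4 + j) (+ 5 / 8) ⟨
  ι ((5 + j) !) ℚ.* (expSum (5 + j) ℚ.- + 5 / 8) ∎
  where open ≡-Reasoning

corollary2p9 : IsRamseyNumber 4 51 →
    (n : ℕ) → 4 ≤ n → (N : ℕ) → IsRamseyNumber n N →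
    fromℕ N ≤ᴿ fromℕ (n !) *ᴿ (e -ᴿ fromℚ (+ 5 / 8)) +ᴿ fromℕ 1
corollary2p9 R₄ n@(suc (suc (suc (suc j)))) (s≤s (s≤s (s≤s (s≤s _)))) N Rₙ ε 0<ε =
  -- From index `n` on, the partial sums dominate `expSum n`, so the inequality already holds
  -- without slack and `ε` is added at the end.
  n , λ m n≤m →
  let bₘ = ι (n !) ℚ.* (expSum m ℚ.- + 5 / 8) ℚ.+ 1ℚ in begin
    ι N                                              ≤⟨ ι-mono-≤ N≤1+bound ⟩
    ι (suc (bound j))                                ≡⟨ ι-suc (bound j) ⟩
    ι (bound j) ℚ.+ 1ℚ                               ≡⟨ cong (ℚ._+ 1ℚ) (bound-closed-form j) ⟩
    ι (n !) ℚ.* (expSum n ℚ.- + 5 / 8) ℚ.+ 1ℚ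
      ≤⟨ ℚ.+-monoˡ-≤ 1ℚ (ℚ.*-monoˡ-≤-nonNeg (ι (n !)) {{ℚ.normalize-nonNeg (n !) 1}}
           (ℚ.+-monoˡ-≤ (ℚ.- (+ 5 / 8)) (expSum-mono-≤ n≤m))) ⟩
    bₘ                                               ≡⟨ ℚ.+-identityʳ bₘ ⟨
    bₘ ℚ.+ 0ℚ                                        ≤⟨ ℚ.+-monoʳ-≤ bₘ (ℚ.<⇒≤ 0<ε) ⟩
    bₘ ℚ.+ ε                                         ∎
  where
  open ℚ.≤-Reasoning
  N≤1+bound : N ≤ suc (bound j)
  -- Minimality of `N` turns forcing at `suc (bound j)` vertices into an upper bound.
  N≤1+bound = IsRamseyNumber.least Rₙ (suc (bound j)) (s≤s z≤n)
    (forces-bound (IsRamseyNumber.forces R₄) j)
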